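{- Let $T\subset\mathbb{R}^d$ be a finite training set, each point of $T$ having a known classification. The nearest-neighbor classifications obtained from the set $R\subseteq T$ of relevant points identified by the relevant-points algorithm on input $T$ equal the nearest-neighbor classifications obtained from the whole training set $T$.
   Context: Classifications are discrete; they are not assumed to be binary, and $T$ is not assumed to be in general position. Nearest-neighbor classification: from a set of classified points, the classification of a point of $\mathbb{R}^d$ is inferred to be the classification of the nearest point (in Euclidean distance) of the set. A Euclidean minimum spanning tree of $T$ is a minimum spanning tree of the complete graph on $T$ with edges weighted by Euclidean distance (equal distances are allowed, so there may be more than one). The extreme points of a finite set are the vertices of its convex hull. Inversion through the unit sphere centered at $r$ maps $x\ne r$ to $r+(x-r)/\|x-r\|^2$. The relevant-points algorithm, on input $T$: (1) Find a Euclidean minimum spanning tree of $T$. (2) Find the tree edges whose two endpoints have different classifications, and initialize the set $R$ of relevant points to consist of the endpoints of these edges. (3) For each relevant point $r$ added to $R$ (either initially or within this loop): (a) invert through the unit sphere centered at $r$ all of the training points whose classification differs from that of $r$, producing a point set $S_r$, including also $r$ itself in $S_r$; (b) identify the extreme points of $S_r$; (c) add to $R$ the training points corresponding to extreme points of $S_r$. The points identified by the algorithm are the points of the final set $R$.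
   Formalization: The training set is assumed to contain points of at least two different classifications; if all points of a non-empty training set share one classification, the algorithm returns the empty set, from which no nearest-neighbor classification is defined. -}

module Defs where

open import Level using (Level; _⊔_)
import Level
open import Algebra.Bundles using (CommutativeRing)
open import Data.Nat.Base as ℕ using (ℕ)
open import Data.Fin.Base as Fin using (Fin; zero; suc; inject₁; fromℕ)
open import Data.List.Base using (List; foldr)
open import Data.List.Membership.Propositional using (_∈_)
open import Data.List.Relation.Unary.All using (All)
open import Data.List.Relation.Unary.Unique.Propositional using (Unique)
open import Data.Product.Base using (_×_; _,_; ∃; ∃₂; Σ-syntax; ∃-syntax; uncurry)
open import Data.Sum.Base using (_⊎_)
open import Data.Vec.Functional using (Vector)
open import Function.Definitions using (Injective)
open import Relation.Nullary.Negation.Core using (¬_)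
open import Relation.Unary using (Pred)
open import Relation.Binary.Core using (Rel)
open import Relation.Binary.Structures using (IsDecTotalOrder)
open import Relation.Binary.Construct.Closure.ReflexiveTransitive using (Star)
open import Relation.Binary.PropositionalEquality.Core using (_≡_; _≢_)

import Algebra.Properties.Monoid.Sum as Sum
import Relation.Binary.Construct.NonStrictToStrict as Strict

-- The real numbers, axiomatised as a Dedekind-complete ordered field, which
-- classically determines them up to unique isomorphism.
record Reals (c ℓ₁ ℓ₂ : Level) : Set (Level.suc (c ⊔ ℓ₁ ⊔ ℓ₂)) where
  field
    commutativeRing : CommutativeRing c ℓ₁

  open CommutativeRing commutativeRing public

  infix  4 _≤_
  infix  8 _⁻¹

  field
    _≤_             : Rel Carrier ℓ₂
    isDecTotalOrder : IsDecTotalOrder _≈_ _≤_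

  open Strict _≈_ _≤_ public using (_<_)

  UpperBound : ∀ {p} → Pred Carrier p → Pred Carrier (c ⊔ ℓ₂ ⊔ p)
  UpperBound P b = ∀ x → P x → x ≤ b

  field
    0≉1             : ¬ 0# ≈ 1#
    -- The value of 0# ⁻¹ is left unspecified.
    _⁻¹             : Carrier → Carrier
    ⁻¹-inverseʳ     : ∀ x → ¬ x ≈ 0# → x * x ⁻¹ ≈ 1#

    +-monoˡ-≤       : ∀ z {x y} → x ≤ y → x + z ≤ y + z
    *-nonneg        : ∀ {x y} → 0# ≤ x → 0# ≤ y → 0# ≤ x * y

    -- s is the least upper bound of P.  Leastness is stated positively (nothing
    -- below s bounds P, with a witness); classically this is equivalent to
    -- s being ≤ every upper bound.
    supremum        : (P : Pred Carrier (c ⊔ ℓ₁ ⊔ ℓ₂)) → ∃ P → ∃ (UpperBound P) →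
                      ∃[ s ] UpperBound P s × (∀ y → y < s → ∃[ x ] P x × y < x)

    -- Existence of square roots is a consequence of completeness; √ names them.
    -- The value of √ at negative arguments is left unspecified.
    √               : Carrier → Carrier
    √-nonneg        : ∀ {x} → 0# ≤ x → 0# ≤ √ x
    √-square        : ∀ {x} → 0# ≤ x → √ x * √ x ≈ x

module Euclidean {c ℓ₁ ℓ₂} (ℝ : Reals c ℓ₁ ℓ₂) (d : ℕ) where
  open Reals ℝ
  open Sum +-monoid using (sum)

  Point : Set c
  Point = Vector Carrier d

  infix 4 _≋_
  _≋_ : Rel Point ℓ₁
  x ≋ y = ∀ k → x k ≈ y k

  infixl 6 _⊕_ _⊖_
  _⊕_ _⊖_ : Point → Point → Point
  (x ⊕ y) k = x k + y k
  (x ⊖ y) k = x k - y k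

  infixr 7 _·_
  _·_ : Carrier → Point → Point
  (a · x) k = a * x k

  ‖_‖² : Point → Carrier
  ‖ x ‖² = sum (λ k → x k * x k)

  dist : Point → Point → Carrier
  dist x y = √ ‖ x ⊖ y ‖²

  -- Inversion through the unit sphere centred at r; meaningful for x different from r.
  invert : Point → Point → Point
  invert r x = r ⊕ ‖ x ⊖ r ‖² ⁻¹ · (x ⊖ r)

  ConvexHull : ∀ {p} → Pred Point p → Pred Point (c ⊔ ℓ₁ ⊔ ℓ₂ ⊔ p)
  ConvexHull S x =
    Σ[ m ∈ ℕ ] Σ[ p ∈ (Fin m → Point) ] Σ[ w ∈ (Fin m → Carrier) ]
      (∀ i → S (p i)) × (∀ i → 0# ≤ w i) × sum w ≈ 1# ×
      (∀ k → x k ≈ sum (λ i → w i * p i k))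

  -- The vertices of the convex hull of S: points of the hull that are not in the
  -- relative interior of a nondegenerate segment contained in the hull.
  Extreme : ∀ {p} → Pred Point p → Pred Point (c ⊔ ℓ₁ ⊔ ℓ₂ ⊔ p)
  Extreme S x =
    ConvexHull S x ×
    (∀ y z → ConvexHull S y → ConvexHull S z →
     ∀ t → 0# < t → t < 1# → x ≋ t · y ⊕ (1# - t) · z → y ≋ z)

-- A simple graph on Fin n is given by the list, without repetition, of its
-- edges, the edge {i , j} with i < j being listed as (i , j).
module Graph {n : ℕ} where

  Edges : Set
  Edges = List (Fin n × Fin n)

  IsSimpleGraph : Pred Edges _
  IsSimpleGraph E = All (uncurry Fin._<_) E × Unique E

  Adjacent : Edges → Rel (Fin n) _
  Adjacent E i j = (i , j) ∈ E ⊎ (j , i) ∈ E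

  Connected : Pred Edges _
  Connected E = ∀ i j → Star (Adjacent E) i j

  -- A closed path through at least three distinct vertices.
  Cycle : Pred Edges _
  Cycle E =
    Σ[ m ∈ ℕ ] Σ[ v ∈ (Fin (3 ℕ.+ m) → Fin n) ]
      Injective _≡_ _≡_ v ×
      (∀ k → Adjacent E (v (inject₁ k)) (v (suc k))) ×
      Adjacent E (v (fromℕ (2 ℕ.+ m))) (v zero)

  IsSpanningTree : Pred Edges _
  IsSpanningTree E = IsSimpleGraph E × Connected E × ¬ Cycle E

-- The training set is the image of T; in use, T is injective, so that its
-- points and subsets can be referred to by their indices.
module Training {c ℓ₁ ℓ₂} (ℝ : Reals c ℓ₁ ℓ₂) {d n : ℕ} {C : Set}
                (T : Fin n → Euclidean.Point ℝ d) (class : Fin n → C) where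
  open Reals ℝ
  open Euclidean ℝ d
  open Graph {n}

  weight : Edges → Carrier
  weight = foldr (λ (i , j) s → dist (T i) (T j) + s) 0#

  IsEuclideanMST : Pred Edges _
  IsEuclideanMST E =
    IsSpanningTree E × (∀ E′ → IsSpanningTree E′ → weight E ≤ weight E′)

  -- Inverted r t x: the point x of S_r corresponds to the training point t.
  data Inverted (r : Fin n) : Fin n → Point → Set c where
    centre : Inverted r r (T r)
    image  : ∀ {t} → class t ≢ class r → Inverted r t (invert (T r) (T t))

  InvertedSet : Fin n → Pred Point c
  InvertedSet r x = ∃[ t ] Inverted r t x

  -- The final set R computed from the spanning tree E: the least set containing
  -- the initial points and closed under the loop body.
  data Relevant (E : Edges) : Pred (Fin n) (c ⊔ ℓ₁ ⊔ ℓ₂) where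
    initialˡ : ∀ {i j} → (i , j) ∈ E → class i ≢ class j → Relevant E i
    initialʳ : ∀ {i j} → (i , j) ∈ E → class i ≢ class j → Relevant E j
    step     : ∀ {r t x} → Relevant E r → Inverted r t x →
               Extreme (InvertedSet r) x → Relevant E t

  -- i is a nearest point to q among the training points in S.
  Nearest : ∀ {p} → Pred (Fin n) p → Point → Pred (Fin n) (ℓ₂ ⊔ p)
  Nearest S q i = S i × (∀ j → S j → dist q (T i) ≤ dist q (T j))

  -- Ties are allowed, so a query point may receive several classifications.
  NNClassification : ∀ {p} → Pred (Fin n) p → Point → Pred C (ℓ₂ ⊔ p)
  NNClassification S q k = ∃[ i ] Nearest S q i × class i ≡ k

{-# OPTIONS --safe #-}
-- Let r be relevant and let a point u of another class be closer to a query q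
-- than r is.  Inversion about r turns the open ball of centre q through r into an
-- open half-space that misses r, and the image of u lies in it.  Hence so does an
-- extreme point of S_r, and the training point it comes from is relevant and closer
-- to q than r.  Consequently, if r is a relevant point nearest to q, every training
-- point closer to q than r has the class of r.  If j is nearest to q, with ties,
-- apply this to a query moved from q slightly towards j.  The spanning tree
-- serves only to provide one relevant point.
module Submission where

open import Defs
open import Level using (_⊔_)
open import Algebra.Bundles using (CommutativeRing)
import Algebra.Solver.Ring as RingSolver
open import Algebra.Solver.Ring.AlmostCommutativeRing using (_-Raw-AlmostCommutative⟶_; fromCommutativeRing)
open import Data.Fin.Base using (Fin; zero; suc)
open import Data.Integer.Base as ℤ using (ℤ; +_; -[1+_])
import Data.Integer.Properties as ℤ
open import Data.List.Base using (tabulate; filter; allFin)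
open import Data.List.Membership.Propositional.Properties using (∈-allFin; ∈-filter⁺)
import Data.List.Relation.Unary.All as All
import Data.List.Relation.Unary.All.Properties as All
import Data.Maybe.Base as Maybe
open import Data.Nat.Base as ℕ using (ℕ; zero; suc)
import Data.Nat.Properties as ℕ
open import Data.Product.Base using (∃; ∃₂; ∃-syntax; _×_; _,_; proj₁; proj₂)
open import Data.Sum.Base using (_⊎_; inj₁; inj₂)
open import Data.Unit.Base using (tt)
open import Function.Base using (_∘_)
open import Function.Bundles using (_⇔_; mk⇔)
open import Function.Definitions using (Injective)
open import Relation.Binary.Bundles using (DecTotalOrder)
open import Relation.Binary.Consequences using (dec⇒weaklyDec)
open import Relation.Binary.Construct.Closure.ReflexiveTransitive using (Star; ε; _◅_)
open import Relation.Binary.Definitions using (DecidableEquality)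
open import Relation.Binary.PropositionalEquality.Core as ≡ using (_≡_; _≢_)
open import Relation.Binary.Structures using (IsDecTotalOrder)
open import Relation.Nullary using (¬_; Dec; yes; no; contradiction)
open import Relation.Unary using (Pred; Decidable; U)

-- Integer coefficients for the ring solver.

module IntegerCoefficients {c ℓ} (R : CommutativeRing c ℓ) where
  open CommutativeRing R
  open import Algebra.Properties.Ring ring
  open import Algebra.Properties.Monoid.Mult.TCOptimised +-monoid using (×-homo-+; 1+×)
  open import Algebra.Properties.Semiring.Mult.TCOptimised semiring using (×1-homo-*)
  open import Algebra.Definitions.RawMonoid +-rawMonoid using (_×′_)
  open import Relation.Binary.Reasoning.Setoid setoid

  -- The canonical homomorphism from ℤ. Since `1 ×′ 1#` is `1#` by definition, `con (+ 1)` in a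
  -- solver equation stands for `1#` itself.
  ⟦_⟧ : ℤ → Carrier
  ⟦ + n ⟧      = n ×′ 1#
  ⟦ -[1+ n ] ⟧ = - (suc n ×′ 1#)

  ⟦⟧-homo-neg : ∀ i → ⟦ ℤ.- i ⟧ ≈ - ⟦ i ⟧
  ⟦⟧-homo-neg (+ zero)  = sym -0#≈0#
  ⟦⟧-homo-neg (+ suc n) = refl
  ⟦⟧-homo-neg -[1+ n ]  = sym (-‿involutive _)

  +-cancel-difference : ∀ x y z → (x + y) - (x + z) ≈ y - z
  +-cancel-difference x y z = begin
    (x + y) + - (x + z)    ≈⟨ +-cong (+-comm x y) (sym (-‿+-comm x z)) ⟩
    (y + x) + (- x + - z)  ≈⟨ +-assoc y x _ ⟩
    y + (x + (- x + - z))  ≈⟨ +-congˡ (+-assoc x (- x) (- z)) ⟨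
    y + ((x + - x) + - z)  ≈⟨ +-congˡ (+-congʳ (-‿inverseʳ x)) ⟩
    y + (0# + - z)         ≈⟨ +-congˡ (+-identityˡ _) ⟩
    y - z                  ∎

  ⟦⟧-homo-⊖ : ∀ m n → ⟦ m ℤ.⊖ n ⟧ ≈ m ×′ 1# - n ×′ 1#
  ⟦⟧-homo-⊖ zero    zero    = sym (-‿inverseʳ 0#)
  ⟦⟧-homo-⊖ zero    (suc n) = sym (+-identityˡ _)
  ⟦⟧-homo-⊖ (suc m) zero    = sym (trans (+-congˡ -0#≈0#) (+-identityʳ _))
  ⟦⟧-homo-⊖ (suc m) (suc n) = begin
    ⟦ suc m ℤ.⊖ suc n ⟧                ≡⟨ ≡.cong ⟦_⟧ (ℤ.[1+m]⊖[1+n]≡m⊖n m n) ⟩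
    ⟦ m ℤ.⊖ n ⟧                        ≈⟨ ⟦⟧-homo-⊖ m n ⟩
    m ×′ 1# - n ×′ 1#                    ≈⟨ +-cancel-difference 1# _ _ ⟨
    (1# + m ×′ 1#) - (1# + n ×′ 1#)      ≈⟨ +-cong (1+× m 1#) (-‿cong (1+× n 1#)) ⟨
    suc m ×′ 1# - suc n ×′ 1#            ∎

  ⟦⟧-homo-+ : ∀ i j → ⟦ i ℤ.+ j ⟧ ≈ ⟦ i ⟧ + ⟦ j ⟧
  ⟦⟧-homo-+ (+ m)    (+ n)    = ×-homo-+ 1# m n
  ⟦⟧-homo-+ (+ m)    -[1+ n ] = ⟦⟧-homo-⊖ m (suc n)
  ⟦⟧-homo-+ -[1+ m ] (+ n)    = trans (⟦⟧-homo-⊖ n (suc m)) (+-comm _ _)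
  ⟦⟧-homo-+ -[1+ m ] -[1+ n ] = begin
    - (suc (suc (m ℕ.+ n)) ×′ 1#)      ≡⟨ ≡.cong (λ k → - (suc k ×′ 1#)) (ℕ.+-suc m n) ⟨
    - ((suc m ℕ.+ suc n) ×′ 1#)        ≈⟨ -‿cong (×-homo-+ 1# (suc m) (suc n)) ⟩
    - (suc m ×′ 1# + suc n ×′ 1#)       ≈⟨ -‿+-comm _ _ ⟨
    - (suc m ×′ 1#) - suc n ×′ 1#       ∎

  ⟦⟧-homo-+* : ∀ m n → ⟦ + m ℤ.* + n ⟧ ≈ ⟦ + m ⟧ * ⟦ + n ⟧
  ⟦⟧-homo-+* m n = trans (reflexive (≡.cong ⟦_⟧ (≡.sym (ℤ.pos-* m n)))) (×1-homo-* m n)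

  ⟦⟧-homo-*ˡ : ∀ m j → ⟦ + m ℤ.* j ⟧ ≈ ⟦ + m ⟧ * ⟦ j ⟧
  ⟦⟧-homo-*ˡ m (+ n)    = ⟦⟧-homo-+* m n
  ⟦⟧-homo-*ˡ m -[1+ n ] = begin
    ⟦ + m ℤ.* -[1+ n ] ⟧        ≡⟨ ≡.cong ⟦_⟧ (ℤ.neg-distribʳ-* (+ m) (+ suc n)) ⟨
    ⟦ ℤ.- (+ m ℤ.* + suc n) ⟧   ≈⟨ ⟦⟧-homo-neg (+ m ℤ.* + suc n) ⟩
    - ⟦ + m ℤ.* + suc n ⟧       ≈⟨ -‿cong (⟦⟧-homo-+* m (suc n)) ⟩
    - (⟦ + m ⟧ * ⟦ + suc n ⟧)   ≈⟨ -‿distribʳ-* _ _ ⟩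
    ⟦ + m ⟧ * ⟦ -[1+ n ] ⟧      ∎

  ⟦⟧-homo-* : ∀ i j → ⟦ i ℤ.* j ⟧ ≈ ⟦ i ⟧ * ⟦ j ⟧
  ⟦⟧-homo-* (+ m)    j = ⟦⟧-homo-*ˡ m j
  ⟦⟧-homo-* -[1+ m ] j = begin
    ⟦ -[1+ m ] ℤ.* j ⟧          ≡⟨ ≡.cong ⟦_⟧ (ℤ.neg-distribˡ-* (+ suc m) j) ⟨
    ⟦ ℤ.- (+ suc m ℤ.* j) ⟧     ≈⟨ ⟦⟧-homo-neg (+ suc m ℤ.* j) ⟩
    - ⟦ + suc m ℤ.* j ⟧         ≈⟨ -‿cong (⟦⟧-homo-*ˡ (suc m) j) ⟩
    - (⟦ + suc m ⟧ * ⟦ j ⟧)     ≈⟨ -‿distribˡ-* _ _ ⟩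
    ⟦ -[1+ m ] ⟧ * ⟦ j ⟧        ∎

  ⟦⟧-morphism : ℤ.+-*-rawRing -Raw-AlmostCommutative⟶ fromCommutativeRing R
  ⟦⟧-morphism = record
    { ⟦_⟧    = ⟦_⟧
    ; +-homo = ⟦⟧-homo-+
    ; *-homo = ⟦⟧-homo-*
    ; -‿homo = ⟦⟧-homo-neg
    ; 0-homo = refl
    ; 1-homo = refl
    }

  open RingSolver ℤ.+-*-rawRing (fromCommutativeRing R) ⟦⟧-morphism
    (λ i j → Maybe.map (reflexive ∘ ≡.cong ⟦_⟧) (dec⇒weaklyDec ℤ._≟_ i j)) public
    using (solve; con; _:=_; _:+_; _:*_; _:-_; :-_)

-- Order, square roots and finite extrema in the reals.

module RealProperties {c ℓ₁ ℓ₂} (ℝ : Reals c ℓ₁ ℓ₂) where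
  open Reals ℝ hiding (zero)
  open IsDecTotalOrder isDecTotalOrder public
    using (_≟_; _≤?_; antisym; total; ≤-respˡ-≈; ≤-respʳ-≈)
    renaming (refl to ≤-refl; trans to ≤-trans; reflexive to ≤-reflexive)

  decTotalOrder : DecTotalOrder c ℓ₁ ℓ₂
  decTotalOrder = record { isDecTotalOrder = isDecTotalOrder }

  open DecTotalOrder decTotalOrder using (poset; totalOrder)
  open import Relation.Binary.Properties.DecTotalOrder decTotalOrder public using (≰⇒>; <⇒≱)
  open import Relation.Binary.Reasoning.PartialOrder poset
  open import Data.List.Extrema totalOrder
    using (max; ⊥≤max; xs≤max; argmin; argmin-all; f[argmin]≤f[xs]; argmax; f[xs]≤f[argmax])
  open import Algebra.Properties.Semiring.Sum semiring using (sum)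

  open IntegerCoefficients commutativeRing public
    using (solve; con; _:=_; _:+_; _:*_; _:-_; :-_)

  x≤y⇒0≤y-x : ∀ {x y} → x ≤ y → 0# ≤ y - x
  x≤y⇒0≤y-x {x} x≤y = ≤-respˡ-≈ (-‿inverseʳ x) (+-monoˡ-≤ (- x) x≤y)

  -- Reduces an inequality to a certificate `z` known to be nonnegative and a ring identity for the
  -- solver; `<-by` does the same for strict inequalities.
  ≤-by : ∀ {x y z} → 0# ≤ z → z ≈ y - x → x ≤ y
  ≤-by {x} {y} {z} 0≤z z≈y-x = begin
    x          ≈⟨ +-identityˡ x ⟨
    0# + x     ≤⟨ +-monoˡ-≤ x 0≤z ⟩
    z + x      ≈⟨ +-congʳ z≈y-x ⟩
    y - x + x  ≈⟨ solve 2 (λ x y → y :- x :+ x := y) refl x y ⟩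
    y          ∎

  x<y⇒0<y-x : ∀ {x y} → x < y → 0# < y - x
  x<y⇒0<y-x {x} {y} x<y = ≰⇒> λ y-x≤0 → <⇒≱ x<y
    (≤-by (x≤y⇒0≤y-x y-x≤0) (solve 2 (λ x y → con (+ 0) :- (y :- x) := x :- y) refl x y))

  <-by : ∀ {x y z} → 0# < z → z ≈ y - x → x < y
  <-by {x} {y} {z} 0<z z≈y-x = ≰⇒> λ y≤x → <⇒≱ 0<z
    (≤-by (x≤y⇒0≤y-x y≤x)
      (trans (solve 2 (λ x y → x :- y := con (+ 0) :- (y :- x)) refl x y)
             (+-congˡ (-‿cong (sym z≈y-x)))))

  x-y≈0⇒x≈y : ∀ {x y} → x - y ≈ 0# → x ≈ y
  x-y≈0⇒x≈y {x} {y} x-y≈0 = begin-equality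
    x          ≈⟨ solve 2 (λ x y → x := x :- y :+ y) refl x y ⟩
    x - y + y  ≈⟨ +-congʳ x-y≈0 ⟩
    0# + y     ≈⟨ +-identityˡ y ⟩
    y          ∎

  +-nonneg : ∀ {x y} → 0# ≤ x → 0# ≤ y → 0# ≤ x + y
  +-nonneg {x} {y} 0≤x 0≤y = begin
    0#      ≤⟨ 0≤y ⟩
    y       ≈⟨ +-identityˡ y ⟨
    0# + y  ≤⟨ +-monoˡ-≤ y 0≤x ⟩
    x + y   ∎

  +-pos-nonneg : ∀ {x y} → 0# < x → 0# ≤ y → 0# < x + y
  +-pos-nonneg {x} {y} 0<x 0≤y = begin-strict
    0#     <⟨ 0<x ⟩
    x      ≤⟨ ≤-by 0≤y (solve 2 (λ x y → y := x :+ y :- x) refl x y) ⟩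
    x + y  ∎

  x*y≈0⇒y≈0 : ∀ {x y} → ¬ x ≈ 0# → x * y ≈ 0# → y ≈ 0#
  x*y≈0⇒y≈0 {x} {y} x≉0 xy≈0 = begin-equality
    y                ≈⟨ *-identityˡ y ⟨
    1# * y           ≈⟨ *-congʳ (⁻¹-inverseʳ x x≉0) ⟨
    x * x ⁻¹ * y     ≈⟨ solve 3 (λ x x⁻¹ y → x :* x⁻¹ :* y := x⁻¹ :* (x :* y)) refl x (x ⁻¹) y ⟩
    x ⁻¹ * (x * y)   ≈⟨ *-congˡ xy≈0 ⟩
    x ⁻¹ * 0#        ≈⟨ zeroʳ _ ⟩
    0#               ∎

  *-pos : ∀ {x y} → 0# < x → 0# < y → 0# < x * y
  *-pos (0≤x , 0≉x) (0≤y , 0≉y) =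
    *-nonneg 0≤x 0≤y , λ 0≈xy → 0≉y (sym (x*y≈0⇒y≈0 (0≉x ∘ sym) (sym 0≈xy)))

  *-pos-cancelˡ : ∀ {x y} → 0# ≤ x → 0# < x * y → 0# < y
  *-pos-cancelˡ {x} {y} 0≤x 0<xy = ≰⇒> λ y≤0 → <⇒≱ 0<xy
    (≤-by (*-nonneg 0≤x (x≤y⇒0≤y-x y≤0))
          (solve 2 (λ x y → x :* (con (+ 0) :- y) := con (+ 0) :- x :* y) refl x y))

  x*x≥0 : ∀ x → 0# ≤ x * x
  x*x≥0 x with total 0# x
  ... | inj₁ 0≤x = *-nonneg 0≤x 0≤x
  ... | inj₂ x≤0 = ≤-respʳ-≈
    (solve 1 (λ x → (con (+ 0) :- x) :* (con (+ 0) :- x) := x :* x) refl x)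
    (*-nonneg (x≤y⇒0≤y-x x≤0) (x≤y⇒0≤y-x x≤0))

  x*x≈0⇒x≈0 : ∀ {x} → x * x ≈ 0# → x ≈ 0#
  x*x≈0⇒x≈0 {x} xx≈0 with x ≟ 0#
  ... | yes x≈0 = x≈0
  ... | no  x≉0 = x*y≈0⇒y≈0 x≉0 xx≈0

  0<1 : 0# < 1#
  0<1 = ≤-respʳ-≈ (*-identityˡ 1#) (x*x≥0 1#) , 0≉1

  ⁻¹-pos : ∀ {x} → 0# < x → 0# < x ⁻¹
  ⁻¹-pos {x} 0<x@(0≤x , 0≉x) = *-pos-cancelˡ 0≤x
    (begin-strict 0# <⟨ 0<1 ⟩ 1# ≈⟨ ⁻¹-inverseʳ x (0≉x ∘ sym) ⟨ x * x ⁻¹ ∎)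

  square-mono-< : ∀ {x y} → 0# ≤ x → x < y → x * x < y * y
  square-mono-< {x} {y} 0≤x x<y = <-by
    (*-pos (x<y⇒0<y-x x<y) (+-pos-nonneg (begin-strict 0# ≤⟨ 0≤x ⟩ x <⟨ x<y ⟩ y ∎) 0≤x))
    (solve 2 (λ x y → (y :- x) :* (y :+ x) := y :* y :- x :* x) refl x y)

  √-mono-≤ : ∀ {x y} → 0# ≤ x → 0# ≤ y → x ≤ y → √ x ≤ √ y
  √-mono-≤ {x} {y} 0≤x 0≤y x≤y with √ x ≤? √ y
  ... | yes √x≤√y = √x≤√y
  ... | no  √x≰√y = contradiction x≤y (<⇒≱ (begin-strict
    y          ≈⟨ √-square 0≤y ⟨
    √ y * √ y  <⟨ square-mono-< (√-nonneg 0≤y) (≰⇒> √x≰√y) ⟩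
    √ x * √ x  ≈⟨ √-square 0≤x ⟩
    x          ∎))

  √-cancel-≤ : ∀ {x y} → 0# ≤ x → 0# ≤ y → √ x ≤ √ y → x ≤ y
  √-cancel-≤ {x} {y} 0≤x 0≤y √x≤√y = ≤-by
    (*-nonneg (x≤y⇒0≤y-x √x≤√y) (+-nonneg (√-nonneg 0≤y) (√-nonneg 0≤x)))
    (trans (solve 2 (λ x y → (y :- x) :* (y :+ x) := y :* y :- x :* x) refl (√ x) (√ y))
           (+-cong (√-square 0≤y) (-‿cong (√-square 0≤x))))

  -- The supremum of {0} ∪ {1 ∣ A} is positive exactly when A holds.
  excluded-middle : (A : Set (c ⊔ ℓ₁ ⊔ ℓ₂)) → Dec A
  excluded-middle A = decide (supremum P (0# , inj₁ refl) (1# , P≤1))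
    where
    P : Pred Carrier (c ⊔ ℓ₁ ⊔ ℓ₂)
    P x = x ≈ 0# ⊎ (x ≈ 1# × A)

    P≤1 : UpperBound P 1#
    P≤1 x (inj₁ x≈0)       = ≤-respˡ-≈ (sym x≈0) (proj₁ 0<1)
    P≤1 x (inj₂ (x≈1 , _)) = ≤-reflexive x≈1

    decide : ∃[ s ] UpperBound P s × (∀ y → y < s → ∃[ x ] P x × y < x) → Dec A
    decide (s , P≤s , least) with s ≤? 0#
    ... | yes s≤0 = no λ a → <⇒≱ 0<1 (≤-trans (P≤s 1# (inj₂ (refl , a))) s≤0)
    ... | no  s≰0 with least 0# (≰⇒> s≰0)
    ...   | x , inj₁ x≈0 , 0<x     = contradiction (sym x≈0) (proj₂ 0<x)
    ...   | x , inj₂ (_ , a) , _   = yes a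

  minimum : ∀ {n p} {P : Pred (Fin n) p} → Decidable P → (f : Fin n → Carrier) →
            ∃ P → ∃[ i ] P i × (∀ j → P j → f i ≤ f j)
  minimum {n} P? f (i₀ , Pi₀) =
    -- `argmin` may return its default `i₀`, which satisfies `P` as the listed indices do.
    argmin f i₀ xs ,
    argmin-all f Pi₀ (All.all-filter P? (allFin n)) ,
    λ j Pj → All.lookup (f[argmin]≤f[xs] i₀ xs) (∈-filter⁺ P? (∈-allFin j) Pj)
    where xs = filter P? (allFin n)

  maximum : ∀ {n} (f : Fin n → Carrier) → Fin n → ∃[ i ] ∀ j → f j ≤ f i
  maximum {n} f i₀ =
    argmax f i₀ (allFin n) , λ j → All.lookup (f[xs]≤f[argmax] i₀ (allFin n)) (∈-allFin j)

  -- Where `x i` is positive, `K` has to exceed the quotient of `y i` by `x i`, and one more than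
  -- the maximum of 0 and all quotients does. Quotients at the remaining indices can only enlarge
  -- `K`.
  large-scale : ∀ {n} (x y : Fin n → Carrier) →
                ∃[ K ] 1# ≤ K × (∀ i → 0# < x i → y i < K * x i)
  large-scale x y =
    1# + M ,
    ≤-by (⊥≤max 0# quotients) (solve 1 (λ M → M := con (+ 1) :+ M :- con (+ 1)) refl M) ,
    λ i 0<xᵢ → let M-q = x≤y⇒0≤y-x (All.tabulate⁻ (xs≤max 0# quotients) i) in
      <-by (+-pos-nonneg 0<xᵢ (*-nonneg (proj₁ 0<xᵢ) M-q)) (identity (x i) (y i) (proj₂ 0<xᵢ ∘ sym))
    where
    quotients = tabulate (λ i → y i * x i ⁻¹)
    M = max 0# quotients

    identity : ∀ x y → ¬ x ≈ 0# → x + x * (M - y * x ⁻¹) ≈ (1# + M) * x - y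
    identity x y x≉0 = begin-equality
      x + x * (M - y * x ⁻¹)
        ≈⟨ solve 4 (λ x y x⁻¹ M → x :+ x :* (M :- y :* x⁻¹)
                     := (con (+ 1) :+ M) :* x :- x :* x⁻¹ :* y) refl x y (x ⁻¹) M ⟩
      (1# + M) * x - x * x ⁻¹ * y
        ≈⟨ +-congˡ (-‿cong (trans (*-congʳ (⁻¹-inverseʳ x x≉0)) (*-identityˡ y))) ⟩
      (1# + M) * x - y ∎

  sum-nonneg : ∀ {n} (f : Fin n → Carrier) → (∀ i → 0# ≤ f i) → 0# ≤ sum f
  sum-nonneg {zero}  f 0≤f = ≤-refl
  sum-nonneg {suc n} f 0≤f = +-nonneg (0≤f zero) (sum-nonneg (f ∘ suc) (0≤f ∘ suc))

  sum≤0⇒≈0 : ∀ {n} (f : Fin n → Carrier) → (∀ i → 0# ≤ f i) → sum f ≤ 0# → ∀ i → f i ≈ 0#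
  sum≤0⇒≈0 {suc n} f 0≤f s≤0 zero    = antisym
    (begin
      f zero  ≤⟨ ≤-by (sum-nonneg (f ∘ suc) (0≤f ∘ suc)) (solve 2 (λ x y → y := x :+ y :- x) refl _ _) ⟩
      sum f   ≤⟨ s≤0 ⟩
      0#      ∎)
    (0≤f zero)
  sum≤0⇒≈0 {suc n} f 0≤f s≤0 (suc i) = sum≤0⇒≈0 (f ∘ suc) (0≤f ∘ suc)
    (begin
      sum (f ∘ suc)  ≤⟨ ≤-by (0≤f zero) (solve 2 (λ x y → x := x :+ y :- y) refl _ _) ⟩
      sum f          ≤⟨ s≤0 ⟩
      0#             ∎)
    i

-- Inner products and squared norms.

module EuclideanProperties {c ℓ₁ ℓ₂} (ℝ : Reals c ℓ₁ ℓ₂) (d : ℕ) where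
  open Reals ℝ hiding (zero)
  open RealProperties ℝ
  open Euclidean ℝ d
  open import Algebra.Properties.Semiring.Sum semiring
    using (sum; sum-cong-≋; ∑-distrib-+; ∑-comm; *-distribˡ-sum; *-distribʳ-sum)
  open import Relation.Binary.Reasoning.PartialOrder (DecTotalOrder.poset decTotalOrder)

  infix 8 _∙_
  _∙_ : Point → Point → Carrier
  x ∙ y = sum (λ k → x k * y k)

  ∙-congˡ : ∀ x {y z} → y ≋ z → x ∙ y ≈ x ∙ z
  ∙-congˡ x y≋z = sum-cong-≋ (λ k → *-congˡ (y≋z k))

  ∙-comm : ∀ x y → x ∙ y ≈ y ∙ x
  ∙-comm x y = sum-cong-≋ (λ k → *-comm (x k) (y k))

  ∙-distribˡ-⊕ : ∀ x y z → x ∙ (y ⊕ z) ≈ x ∙ y + x ∙ z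
  ∙-distribˡ-⊕ x y z = trans (sum-cong-≋ (λ k → distribˡ (x k) (y k) (z k))) (∑-distrib-+ {d} _ _)

  ∙-·ʳ : ∀ x t y → x ∙ (t · y) ≈ t * x ∙ y
  ∙-·ʳ x t y = trans
    (sum-cong-≋ (λ k → solve 3 (λ x t y → x :* (t :* y) := t :* (x :* y)) refl (x k) t (y k)))
    (sym (*-distribˡ-sum {d} t _))

  ∙-distribʳ-⊕ : ∀ x y z → (y ⊕ z) ∙ x ≈ y ∙ x + z ∙ x
  ∙-distribʳ-⊕ x y z = trans (sum-cong-≋ (λ k → distribʳ (x k) (y k) (z k))) (∑-distrib-+ {d} _ _)

  ∙-·ˡ : ∀ x t y → (t · y) ∙ x ≈ t * y ∙ x
  ∙-·ˡ x t y = trans (sum-cong-≋ (λ k → *-assoc t (y k) (x k))) (sym (*-distribˡ-sum {d} t _))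

  ∙-distribˡ-⊖ : ∀ x y z → x ∙ (y ⊖ z) ≈ x ∙ y - x ∙ z
  ∙-distribˡ-⊖ x y z = begin-equality
    x ∙ (y ⊖ z)               ≈⟨ ∙-congˡ x (λ k → negate (y k) (z k)) ⟩
    x ∙ (y ⊕ (- 1#) · z)      ≈⟨ ∙-distribˡ-⊕ x y _ ⟩
    x ∙ y + x ∙ ((- 1#) · z)  ≈⟨ +-congˡ (∙-·ʳ x (- 1#) z) ⟩
    x ∙ y + (- 1#) * x ∙ z    ≈⟨ negate (x ∙ y) (x ∙ z) ⟨
    x ∙ y - x ∙ z             ∎
    where
    negate : ∀ y z → y - z ≈ y + (- 1#) * z
    negate = solve 2 (λ y z → y :- z := y :+ (:- con (+ 1)) :* z) refl

  ∙-affine : ∀ b {x s t y z} → x ≋ s · y ⊕ t · z → b ∙ x ≈ s * b ∙ y + t * b ∙ z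
  ∙-affine b {s = s} {t} {y} {z} x≋ =
    trans (∙-congˡ b x≋) (trans (∙-distribˡ-⊕ b _ _) (+-cong (∙-·ʳ b s y) (∙-·ʳ b t z)))

  ∙-combination : ∀ b {m} (w : Fin m → Carrier) (p : Fin m → Point) →
                  b ∙ (λ k → sum (λ i → w i * p i k)) ≈ sum (λ i → w i * b ∙ p i)
  ∙-combination b {m} w p = begin-equality
    sum (λ k → b k * sum (λ i → w i * p i k))    ≈⟨ sum-cong-≋ (λ k → *-distribˡ-sum {m} (b k) _) ⟩
    sum (λ k → sum (λ i → b k * (w i * p i k)))  ≈⟨ ∑-comm {d} {m} _ ⟩
    sum (λ i → sum (λ k → b k * (w i * p i k)))  ≈⟨ sum-cong-≋ (λ i → ∙-·ʳ b (w i) (p i)) ⟩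
    sum (λ i → w i * b ∙ p i)                    ∎

  ‖‖²-cong : ∀ {x y} → x ≋ y → ‖ x ‖² ≈ ‖ y ‖²
  ‖‖²-cong x≋y = sum-cong-≋ (λ k → *-cong (x≋y k) (x≋y k))

  ‖‖²-nonneg : ∀ x → 0# ≤ ‖ x ‖²
  ‖‖²-nonneg x = sum-nonneg _ (λ k → x*x≥0 (x k))

  ‖x⊖y‖²≤0⇒x≋y : ∀ {x y} → ‖ x ⊖ y ‖² ≤ 0# → x ≋ y
  ‖x⊖y‖²≤0⇒x≋y {x} {y} n≤0 k =
    x-y≈0⇒x≈y (x*x≈0⇒x≈0 (sum≤0⇒≈0 _ (λ k → x*x≥0 ((x ⊖ y) k)) n≤0 k))

  ‖x⊖x‖²≈0 : ∀ x → ‖ x ⊖ x ‖² ≈ 0#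
  ‖x⊖x‖²≈0 x = begin-equality
    ‖ x ⊖ x ‖²               ≈⟨ sum-cong-≋ {d} (λ k → vanish (x k)) ⟩
    sum {d} (λ k → 0# * 0#)  ≈⟨ *-distribˡ-sum {d} 0# (λ _ → 0#) ⟨
    0# * sum {d} (λ _ → 0#)  ≈⟨ zeroˡ _ ⟩
    0#                       ∎
    where
    vanish : ∀ x → (x - x) * (x - x) ≈ 0# * 0#
    vanish = solve 1 (λ x → (x :- x) :* (x :- x) := con (+ 0) :* con (+ 0)) refl

  ‖x⊕y‖² : ∀ x y → ‖ x ⊕ y ‖² ≈ ‖ x ‖² + (x ∙ y + x ∙ y) + ‖ y ‖²
  ‖x⊕y‖² x y = begin-equality
    (x ⊕ y) ∙ (x ⊕ y)                  ≈⟨ ∙-distribˡ-⊕ (x ⊕ y) x y ⟩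
    (x ⊕ y) ∙ x + (x ⊕ y) ∙ y          ≈⟨ +-cong (∙-distribʳ-⊕ x x y) (∙-distribʳ-⊕ y x y) ⟩
    (x ∙ x + y ∙ x) + (x ∙ y + y ∙ y)  ≈⟨ +-congʳ (+-congˡ (∙-comm y x)) ⟩
    (x ∙ x + x ∙ y) + (x ∙ y + y ∙ y)  ≈⟨ solve 3 (λ a b c → (a :+ b) :+ (b :+ c) := a :+ (b :+ b) :+ c) refl
                                            (x ∙ x) (x ∙ y) (y ∙ y) ⟩
    x ∙ x + (x ∙ y + x ∙ y) + y ∙ y    ∎

  -- Follows from `‖x⊕y‖²` applied to `x ⊖ y` and `y`, whose sum is `x`.
  ‖x⊖y‖² : ∀ x y → ‖ x ⊖ y ‖² ≈ ‖ x ‖² - (x ∙ y + x ∙ y) + ‖ y ‖²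
  ‖x⊖y‖² x y = begin-equality
    ‖ x ⊖ y ‖²
      ≈⟨ solve 3 (λ m n b → m := (m :+ (b :+ b) :+ n) :- (b :+ b) :- n) refl _ ‖ y ‖² ((x ⊖ y) ∙ y) ⟩
    (‖ x ⊖ y ‖² + ((x ⊖ y) ∙ y + (x ⊖ y) ∙ y) + ‖ y ‖²) - ((x ⊖ y) ∙ y + (x ⊖ y) ∙ y) - ‖ y ‖²
      ≈⟨ +-congʳ (+-cong (sym (‖x⊕y‖² (x ⊖ y) y)) (-‿cong (+-cong left left))) ⟩
    ‖ x ⊖ y ⊕ y ‖² - ((x ∙ y - y ∙ y) + (x ∙ y - y ∙ y)) - ‖ y ‖²
      ≈⟨ +-congʳ (+-congʳ (‖‖²-cong (λ k → solve 2 (λ x y → x :- y :+ y := x) refl (x k) (y k)))) ⟩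
    ‖ x ‖² - ((x ∙ y - y ∙ y) + (x ∙ y - y ∙ y)) - ‖ y ‖²
      ≈⟨ solve 3 (λ a b c → a :- ((b :- c) :+ (b :- c)) :- c := a :- (b :+ b) :+ c) refl
           ‖ x ‖² (x ∙ y) ‖ y ‖² ⟩
    ‖ x ‖² - (x ∙ y + x ∙ y) + ‖ y ‖² ∎
    where
    left : (x ⊖ y) ∙ y ≈ x ∙ y - y ∙ y
    left = trans (∙-comm _ y) (trans (∙-distribˡ-⊖ y x y) (+-congʳ (∙-comm y x)))

  dist-mono-≤ : ∀ {w x y z} → ‖ w ⊖ x ‖² ≤ ‖ y ⊖ z ‖² → dist w x ≤ dist y z
  dist-mono-≤ = √-mono-≤ (‖‖²-nonneg _) (‖‖²-nonneg _)

  dist-cancel-≤ : ∀ {w x y z} → dist w x ≤ dist y z → ‖ w ⊖ x ‖² ≤ ‖ y ⊖ z ‖²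
  dist-cancel-≤ = √-cancel-≤ (‖‖²-nonneg _) (‖‖²-nonneg _)

  -- Exposed points and extreme points.

  record Exposed {p} (S : Pred Point p) (x b : Point) : Set (c ⊔ ℓ₁ ⊔ ℓ₂ ⊔ p) where
    field
      member  : S x
      maximal : ∀ p → S p → b ∙ p ≤ b ∙ x
      unique  : ∀ p → S p → b ∙ x ≤ b ∙ p → p ≋ x

  module _ {p} {S : Pred Point p} {x b} (exposed : Exposed S x b) where
    open Exposed exposed

    module _ {m} {pt : Fin m → Point} {w : Fin m → Carrier} {y : Point}
             (S-pt : ∀ i → S (pt i)) (w-nonneg : ∀ i → 0# ≤ w i) (w-total : sum w ≈ 1#)
             (y≈ : ∀ k → y k ≈ sum (λ i → w i * pt i k)) where
      private
        weighted-constant : ∀ a → sum (λ i → w i * a) ≈ a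
        weighted-constant a =
          trans (sym (*-distribʳ-sum a w)) (trans (*-congʳ w-total) (*-identityˡ a))

        gap : Fin m → Carrier
        gap i = w i * (b ∙ x - b ∙ pt i)

        gap-nonneg : ∀ i → 0# ≤ gap i
        gap-nonneg i = *-nonneg (w-nonneg i) (x≤y⇒0≤y-x (maximal (pt i) (S-pt i)))

        -- By linearity, what `y` lacks from the maximum is the weighted average of what the points
        -- `pt i` lack. All terms being nonnegative, no point of the hull exceeds the maximum.
        sum-gap : sum gap ≈ b ∙ x - b ∙ y
        sum-gap = begin-equality
          sum gap
            ≈⟨ solve 2 (λ g v → g := g :+ v :- v) refl (sum gap) (sum (λ i → w i * b ∙ pt i)) ⟩
          sum gap + sum (λ i → w i * b ∙ pt i) - sum (λ i → w i * b ∙ pt i)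
            ≈⟨ +-cong (sym (∑-distrib-+ gap _)) (-‿cong (sym (∙-combination b w pt))) ⟩
          sum (λ i → gap i + w i * b ∙ pt i) - b ∙ (λ k → sum (λ i → w i * pt i k))
            ≈⟨ +-cong (sum-cong-≋ (λ i → solve 3 (λ w X P → w :* (X :- P) :+ w :* P := w :* X) refl
                                           (w i) (b ∙ x) (b ∙ pt i)))
                      (-‿cong (sym (∙-congˡ b y≈))) ⟩
          sum (λ i → w i * b ∙ x) - b ∙ y
            ≈⟨ +-congʳ (weighted-constant (b ∙ x)) ⟩
          b ∙ x - b ∙ y ∎

      combination-maximal : b ∙ y ≤ b ∙ x
      combination-maximal = ≤-by (sum-nonneg gap gap-nonneg) sum-gap

      -- Equality makes the sum of nonnegative gaps vanish, hence each gap. A point of nonzero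
      -- weight then attains the maximum over `S`, so it is `x`.
      combination-unique : b ∙ x ≤ b ∙ y → y ≋ x
      combination-unique bx≤by k = begin-equality
        y k                        ≈⟨ y≈ k ⟩
        sum (λ i → w i * pt i k)   ≈⟨ sum-cong-≋ weighted ⟩
        sum (λ i → w i * x k)      ≈⟨ weighted-constant (x k) ⟩
        x k                        ∎
        where
        sum-gap≤0 : sum gap ≤ 0#
        sum-gap≤0 = begin
          sum gap        ≈⟨ sum-gap ⟩
          b ∙ x - b ∙ y  ≤⟨ +-monoˡ-≤ (- (b ∙ y)) bx≤by ⟩
          b ∙ y - b ∙ y  ≈⟨ -‿inverseʳ (b ∙ y) ⟩
          0#             ∎

        weighted : ∀ i → w i * pt i k ≈ w i * x k
        weighted i with w i ≟ 0#
        ... | yes w≈0 = trans (trans (*-congʳ w≈0) (zeroˡ _)) (sym (trans (*-congʳ w≈0) (zeroˡ _)))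
        ... | no  w≉0 = *-congˡ (unique (pt i) (S-pt i) (≤-reflexive
          (x-y≈0⇒x≈y (x*y≈0⇒y≈0 w≉0 (sum≤0⇒≈0 gap gap-nonneg sum-gap≤0 i)))) k)

    hull-maximal : ∀ {y} → ConvexHull S y → b ∙ y ≤ b ∙ x
    hull-maximal (_ , _ , _ , S-pt , w-nonneg , w-total , y≈) =
      combination-maximal S-pt w-nonneg w-total y≈

    hull-unique : ∀ {y} → ConvexHull S y → b ∙ x ≤ b ∙ y → y ≋ x
    hull-unique (_ , _ , _ , S-pt , w-nonneg , w-total , y≈) =
      combination-unique S-pt w-nonneg w-total y≈

    private
      -- The combination `s * (X - Y) + t * (X - Z)` vanishes, but would be positive if `Y` were
      -- below `X`.
      endpoint-maximal : ∀ {s t X Y Z} → 0# < s → 0# ≤ t → s + t ≈ 1# →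
                            X ≈ s * Y + t * Z → Z ≤ X → X ≤ Y
      endpoint-maximal {s} {t} {X} {Y} {Z} 0<s 0≤t s+t≈1 X≈ Z≤X with X ≤? Y
      ... | yes X≤Y = X≤Y
      ... | no  X≰Y = contradiction
        (sym (begin-equality
          s * (X - Y) + t * (X - Z)
            ≈⟨ solve 5 (λ s t X Y Z → s :* (X :- Y) :+ t :* (X :- Z)
                         := (s :+ t) :* X :- (s :* Y :+ t :* Z)) refl s t X Y Z ⟩
          (s + t) * X - (s * Y + t * Z)
            ≈⟨ +-cong (trans (*-congʳ s+t≈1) (*-identityˡ X)) (-‿cong (sym X≈)) ⟩
          X - X
            ≈⟨ -‿inverseʳ X ⟩
          0# ∎))
        (proj₂ (+-pos-nonneg (*-pos 0<s (x<y⇒0<y-x (≰⇒> X≰Y))) (*-nonneg 0≤t (x≤y⇒0≤y-x Z≤X))))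

    -- Neither end of a segment through `x` exceeds `x` in direction `b`, so both ends reach the
    -- maximum, and `hull-unique` identifies both with `x`.
    exposed⇒extreme : Extreme S x
    exposed⇒extreme = x∈hull , λ y z y∈ z∈ t 0<t t<1 x≋ k →
      let X≈ = ∙-affine b x≋
          0<1-t = x<y⇒0<y-x t<1
          sum≈1 = solve 1 (λ t → t :+ (con (+ 1) :- t) := con (+ 1)) refl t
          y≋x = hull-unique y∈ (endpoint-maximal 0<t (proj₁ 0<1-t) sum≈1 X≈ (hull-maximal z∈))
          z≋x = hull-unique z∈ (endpoint-maximal 0<1-t (proj₁ 0<t) (trans (+-comm _ _) sum≈1)
                                 (trans X≈ (+-comm _ _)) (hull-maximal y∈))
      in trans (y≋x k) (sym (z≋x k))
      where
      x∈hull : ConvexHull S x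
      x∈hull = 1 , (λ _ → x) , (λ _ → 1#) , (λ _ → member) , (λ _ → proj₁ 0<1) , +-identityʳ 1# ,
               λ k → sym (trans (+-identityʳ _) (*-identityˡ (x k)))

  -- A point of a finite set maximising the strictly convex function K a ∙ x + ‖ x ‖² is
  -- exposed by its gradient there; for large K it is at least as far as p u in direction a.
  extreme-above : ∀ {q} {S : Pred Point q} {n} (p : Fin n → Point) →
                  (∀ i → S (p i)) → (∀ x → S x → ∃[ i ] x ≡ p i) →
                  ∀ a u → ∃[ i ] a ∙ p u ≤ a ∙ p i × Extreme S (p i)
  extreme-above {S = S} {n} p S-p p-onto a u = i , above , exposed⇒extreme exposed
    where
    scale = large-scale (λ j → a ∙ p u - a ∙ p j) (λ j → ‖ p j ‖² - ‖ p u ‖²)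
    K = proj₁ scale

    φ : Point → Carrier
    φ x = K * a ∙ x + ‖ x ‖²

    i   = proj₁ (maximum (φ ∘ p) u)
    φ≤φᵢ = proj₂ (maximum (φ ∘ p) u)

    above : a ∙ p u ≤ a ∙ p i
    above with a ∙ p u ≤? a ∙ p i
    ... | yes above = above
    -- Here the choice of `K` would make φ larger at `p u` than at its maximiser `p i`.
    ... | no  below = contradiction (φ≤φᵢ u) (<⇒≱ (<-by
      (x<y⇒0<y-x (proj₂ (proj₂ scale) i (x<y⇒0<y-x (≰⇒> below))))
      (solve 5 (λ K au ai nu ni → K :* (au :- ai) :- (ni :- nu) := (K :* au :+ nu) :- (K :* ai :+ ni)) refl
        K (a ∙ p u) (a ∙ p i) ‖ p u ‖² ‖ p i ‖²)))

    b = K · a ⊕ (p i ⊕ p i)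

    b∙ : ∀ x → b ∙ x ≈ K * a ∙ x + (p i ∙ x + p i ∙ x)
    b∙ x = trans (∙-distribʳ-⊕ x _ _) (+-cong (∙-·ˡ x K a) (∙-distribʳ-⊕ x _ _))

    -- φ differs from its linearisation at `p i` by exactly the squared distance to `p i`. Both
    -- summands on the left are nonnegative on `S`; the second vanishes only at `p i`, which yields
    -- uniqueness.
    b-gap : ∀ x → (φ (p i) - φ x) + ‖ x ⊖ p i ‖² ≈ b ∙ p i - b ∙ x
    b-gap x = begin-equality
      (φ (p i) - φ x) + ‖ x ⊖ p i ‖²
        ≈⟨ +-congˡ (‖x⊖y‖² x (p i)) ⟩
      (φ (p i) - φ x) + (‖ x ‖² - (x ∙ p i + x ∙ p i) + ‖ p i ‖²)
        ≈⟨ solve 5 (λ kx ki xx xi ii → ((ki :+ ii) :- (kx :+ xx)) :+ (xx :- (xi :+ xi) :+ ii)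
                     := (ki :+ (ii :+ ii)) :- (kx :+ (xi :+ xi))) refl
             (K * a ∙ x) (K * a ∙ p i) ‖ x ‖² (x ∙ p i) ‖ p i ‖² ⟩
      (K * a ∙ p i + (p i ∙ p i + p i ∙ p i)) - (K * a ∙ x + (x ∙ p i + x ∙ p i))
        ≈⟨ +-cong (sym (b∙ (p i))) (-‿cong (trans (+-congˡ (+-cong (∙-comm x _) (∙-comm x _))) (sym (b∙ x)))) ⟩
      b ∙ p i - b ∙ x ∎

    φ-gap : ∀ x → S x → 0# ≤ φ (p i) - φ x
    φ-gap x Sx with p-onto x Sx
    ... | j , ≡.refl = x≤y⇒0≤y-x (φ≤φᵢ j)

    exposed : Exposed S (p i) b
    exposed = record
      { member  = S-p i
      ; maximal = λ x Sx → ≤-by (+-nonneg (φ-gap x Sx) (‖‖²-nonneg _)) (b-gap x)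
      ; unique  = λ x Sx bᵢ≤bₓ → ‖x⊖y‖²≤0⇒x≋y (begin
          ‖ x ⊖ p i ‖²                    ≤⟨ ≤-by (φ-gap x Sx) (solve 2 (λ g n → g := g :+ n :- n) refl _ _) ⟩
          (φ (p i) - φ x) + ‖ x ⊖ p i ‖²  ≈⟨ b-gap x ⟩
          b ∙ p i - b ∙ x                 ≤⟨ +-monoˡ-≤ (- (b ∙ x)) bᵢ≤bₓ ⟩
          b ∙ x - b ∙ x                   ≈⟨ -‿inverseʳ (b ∙ x) ⟩
          0#                              ∎)
      }

  -- Inversion and half-spaces.

  -- This is twice the inner product of `q ⊖ r` with `x ⊖ r`, expanded so that `x` enters only
  -- through `(q ⊖ r) ∙ x`.
  height : Point → Point → Point → Carrier
  height q r x = (q ⊖ r) ∙ x + (q ⊖ r) ∙ x - ((q ⊖ r) ∙ r + (q ⊖ r) ∙ r)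

  height-mono : ∀ {q r x y} → 0# < height q r x - 1# → (q ⊖ r) ∙ x ≤ (q ⊖ r) ∙ y →
                0# < height q r y - 1#
  height-mono {q} {r} {x} {y} 1<hx x≤y = begin-strict
    0#
      <⟨ +-pos-nonneg 1<hx (+-nonneg (x≤y⇒0≤y-x x≤y) (x≤y⇒0≤y-x x≤y)) ⟩
    (height q r x - 1#) + ((a ∙ y - a ∙ x) + (a ∙ y - a ∙ x))
      ≈⟨ solve 3 (λ x y r → (x :+ x :- (r :+ r) :- con (+ 1)) :+ ((y :- x) :+ (y :- x))
                   := y :+ y :- (r :+ r) :- con (+ 1)) refl
           (a ∙ x) (a ∙ y) (a ∙ r) ⟩
    height q r y - 1# ∎
    where a = q ⊖ r

  -- The centre has height 0. This prevents an extreme point found in the half-space from being the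
  -- centre of inversion.
  height-centre : ∀ q r → height q r r - 1# < 0#
  height-centre q r = <-by 0<1
    (solve 1 (λ h → con (+ 1) := con (+ 0) :- (h :+ h :- (h :+ h) :- con (+ 1))) refl ((q ⊖ r) ∙ r))

  -- The half-space height > 1 is the image of the open ball of centre q through r.
  inversion-gap : ∀ q {r u} → ¬ u ≋ r →
                  ‖ q ⊖ r ‖² - ‖ q ⊖ u ‖² ≈ ‖ u ⊖ r ‖² * (height q r (invert r u) - 1#)
  inversion-gap q {r} {u} u≉r = begin-equality
    ‖ a ‖² - ‖ q ⊖ u ‖²
      ≈⟨ +-congˡ (-‿cong (trans (‖‖²-cong (λ k → solve 3 (λ q r u → q :- u := (q :- r) :- (u :- r)) refl
                                                       (q k) (r k) (u k)))
                                (‖x⊖y‖² a v))) ⟩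
    ‖ a ‖² - (‖ a ‖² - (a ∙ v + a ∙ v) + N)
      ≈⟨ solve 3 (λ A g N → A :- (A :- (g :+ g) :+ N) := con (+ 1) :* (g :+ g) :- N) refl ‖ a ‖² (a ∙ v) N ⟩
    1# * (a ∙ v + a ∙ v) - N
      ≈⟨ +-congʳ (*-congʳ (⁻¹-inverseʳ N N≉0)) ⟨
    N * N ⁻¹ * (a ∙ v + a ∙ v) - N
      ≈⟨ solve 4 (λ N M g r → N :* M :* (g :+ g) :- N
                   := N :* ((r :+ M :* g) :+ (r :+ M :* g) :- (r :+ r) :- con (+ 1))) refl
           N (N ⁻¹) (a ∙ v) (a ∙ r) ⟩
    N * ((a ∙ r + N ⁻¹ * a ∙ v) + (a ∙ r + N ⁻¹ * a ∙ v) - (a ∙ r + a ∙ r) - 1#)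
      ≈⟨ *-congˡ (+-congʳ (+-congʳ (+-cong image image))) ⟨
    N * (height q r (invert r u) - 1#) ∎
    where
    a = q ⊖ r
    v = u ⊖ r
    N = ‖ v ‖²

    N≉0 : ¬ N ≈ 0#
    N≉0 N≈0 = u≉r (‖x⊖y‖²≤0⇒x≋y (≤-reflexive N≈0))

    image : a ∙ invert r u ≈ a ∙ r + N ⁻¹ * a ∙ v
    image = trans (∙-distribˡ-⊕ a r _) (+-congˡ (∙-·ʳ a (N ⁻¹) v))

  -- Moving the query towards a point.

  toward : Carrier → Point → Point → Point
  toward δ q j = q ⊕ δ · (j ⊖ q)

  -- Stewart's theorem for the point that divides the segment from `q` to `j`, multiplied through by
  -- `K`, the inverse of `δ`.
  stewart : ∀ {K δ} → K * δ ≈ 1# → ∀ q j x →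
            K * ‖ toward δ q j ⊖ x ‖² ≈
            (K - 1#) * ‖ q ⊖ x ‖² + ‖ j ⊖ x ‖² + (δ - 1#) * ‖ j ⊖ q ‖²
  stewart {K} {δ} Kδ≈1 q j x = begin-equality
    K * ‖ toward δ q j ⊖ x ‖²
      ≈⟨ *-congˡ (trans (‖‖²-cong (λ k → solve 4 (λ δ q j x → (q :+ δ :* (j :- q)) :- x
                                                             := (q :- x) :+ δ :* (j :- q)) refl
                                                δ (q k) (j k) (x k)))
                        (‖x⊕y‖² a (δ · w))) ⟩
    K * (A + (a ∙ (δ · w) + a ∙ (δ · w)) + ‖ δ · w ‖²)
      ≈⟨ *-congˡ (+-cong (+-congˡ (+-cong (∙-·ʳ a δ w) (∙-·ʳ a δ w)))
                         (trans (∙-·ʳ (δ · w) δ w) (*-congˡ (∙-·ˡ w δ w)))) ⟩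
    K * (A + (δ * B + δ * B) + δ * (δ * C))
      ≈⟨ solve 5 (λ K δ A B C → K :* (A :+ (δ :* B :+ δ :* B) :+ δ :* (δ :* C))
                   := K :* A :+ K :* δ :* (B :+ B) :+ K :* δ :* (δ :* C)) refl K δ A B C ⟩
    K * A + K * δ * (B + B) + K * δ * (δ * C)
      ≈⟨ +-cong (+-congˡ (*-congʳ Kδ≈1)) (*-congʳ Kδ≈1) ⟩
    K * A + 1# * (B + B) + 1# * (δ * C)
      ≈⟨ solve 5 (λ K δ A B C → K :* A :+ con (+ 1) :* (B :+ B) :+ con (+ 1) :* (δ :* C)
                   := (K :- con (+ 1)) :* A :+ (A :+ (B :+ B) :+ C) :+ (δ :- con (+ 1)) :* C) refl K δ A B C ⟩
    (K - 1#) * A + (A + (B + B) + C) + (δ - 1#) * C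
      ≈⟨ +-congʳ (+-congˡ (trans (‖‖²-cong (λ k → solve 3 (λ q j x → j :- x := (q :- x) :+ (j :- q)) refl
                                                          (q k) (j k) (x k)))
                                 (‖x⊕y‖² a w))) ⟨
    (K - 1#) * A + ‖ j ⊖ x ‖² + (δ - 1#) * C ∎
    where
    a = q ⊖ x
    w = j ⊖ q
    A = ‖ a ‖²
    B = a ∙ w
    C = ‖ w ‖²

  -- The last term of `stewart` does not depend on `x`, so it cancels when two squared distances are
  -- compared.
  toward-gap : ∀ {K δ} → K * δ ≈ 1# → ∀ q j x y →
               K * (‖ toward δ q j ⊖ y ‖² - ‖ toward δ q j ⊖ x ‖²) ≈
               (K - 1#) * (‖ q ⊖ y ‖² - ‖ q ⊖ x ‖²) + (‖ j ⊖ y ‖² - ‖ j ⊖ x ‖²)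
  toward-gap {K} {δ} Kδ≈1 q j x y = begin-equality
    K * (‖ q′ ⊖ y ‖² - ‖ q′ ⊖ x ‖²)
      ≈⟨ solve 3 (λ K a b → K :* (a :- b) := K :* a :- K :* b) refl K _ _ ⟩
    K * ‖ q′ ⊖ y ‖² - K * ‖ q′ ⊖ x ‖²
      ≈⟨ +-cong (stewart Kδ≈1 q j y) (-‿cong (stewart Kδ≈1 q j x)) ⟩
    _ ≈⟨ solve 6 (λ L qy jy e qx jx → (L :* qy :+ jy :+ e) :- (L :* qx :+ jx :+ e)
                   := L :* (qy :- qx) :+ (jy :- jx)) refl
           (K - 1#) ‖ q ⊖ y ‖² ‖ j ⊖ y ‖² ((δ - 1#) * ‖ j ⊖ q ‖²) ‖ q ⊖ x ‖² ‖ j ⊖ x ‖² ⟩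
    (K - 1#) * (‖ q ⊖ y ‖² - ‖ q ⊖ x ‖²) + (‖ j ⊖ y ‖² - ‖ j ⊖ x ‖²) ∎
    where q′ = toward δ q j

  -- The first clause says that the move is small: no point farther from `q` than `p r` catches up
  -- with `p r`. The second says that ties at `q` are broken in favour of `p j`.
  Perturbation : ∀ {n} → (Fin n → Point) → Point → Fin n → Fin n → Set (c ⊔ ℓ₁ ⊔ ℓ₂)
  Perturbation p q j r =
    ∃[ q′ ] (∀ i → ‖ q′ ⊖ p i ‖² ≤ ‖ q′ ⊖ p r ‖² → ‖ q ⊖ p i ‖² ≤ ‖ q ⊖ p r ‖²) ×
            (∀ i → ‖ q ⊖ p j ‖² ≤ ‖ q ⊖ p i ‖² → ‖ q′ ⊖ p i ‖² ≤ ‖ q′ ⊖ p j ‖² → p i ≋ p j)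

  perturbation : ∀ {n} (p : Fin n → Point) q j r → Perturbation p q j r
  perturbation {n} p q j r = scaled (large-scale excess change)
    where
    -- By `toward-gap`, `K * excess i - change i` is `K` times the amount by which `p i` is farther
    -- than `p r` from the moved query, in squared distances. It has to stay positive wherever
    -- `excess i` is.
    excess change : Fin n → Carrier
    excess i = ‖ q ⊖ p i ‖² - ‖ q ⊖ p r ‖²
    change i = excess i + (‖ p j ⊖ p r ‖² - ‖ p j ⊖ p i ‖²)

    scaled : ∃[ K ] 1# ≤ K × (∀ i → 0# < excess i → change i < K * excess i) → Perturbation p q j r
    scaled (K , 1≤K , change<) = q′ , near-r , near-j
      where
      q′ = toward (K ⁻¹) q (p j)

      0<K : 0# < K
      0<K = begin-strict 0# <⟨ 0<1 ⟩ 1# ≤⟨ 1≤K ⟩ K ∎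

      gap : ∀ x y → K * (‖ q′ ⊖ y ‖² - ‖ q′ ⊖ x ‖²) ≈
                    (K - 1#) * (‖ q ⊖ y ‖² - ‖ q ⊖ x ‖²) + (‖ p j ⊖ y ‖² - ‖ p j ⊖ x ‖²)
      gap = toward-gap (⁻¹-inverseʳ K (proj₂ 0<K ∘ sym)) q (p j)

      near-r : ∀ i → ‖ q′ ⊖ p i ‖² ≤ ‖ q′ ⊖ p r ‖² → ‖ q ⊖ p i ‖² ≤ ‖ q ⊖ p r ‖²
      near-r i i≤r with ‖ q ⊖ p i ‖² ≤? ‖ q ⊖ p r ‖²
      ... | yes i≤r = i≤r
      ... | no  i≰r = contradiction i≤r (<⇒≱ (<-by (*-pos-cancelˡ (proj₁ 0<K) (begin-strict
        0#
          <⟨ x<y⇒0<y-x (change< i (x<y⇒0<y-x (≰⇒> i≰r))) ⟩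
        K * excess i - change i
          ≈⟨ solve 4 (λ K e jr ji → K :* e :- (e :+ (jr :- ji)) := (K :- con (+ 1)) :* e :+ (ji :- jr)) refl
               K (excess i) ‖ p j ⊖ p r ‖² ‖ p j ⊖ p i ‖² ⟩
        (K - 1#) * excess i + (‖ p j ⊖ p i ‖² - ‖ p j ⊖ p r ‖²)
          ≈⟨ gap (p r) (p i) ⟨
        K * (‖ q′ ⊖ p i ‖² - ‖ q′ ⊖ p r ‖²) ∎)) refl))

      -- Taking `x` as `p j` in `gap` leaves the squared distance from `p j` to `p i` plus a
      -- nonnegative term, while the left side is at most 0. So that distance vanishes.
      near-j : ∀ i → ‖ q ⊖ p j ‖² ≤ ‖ q ⊖ p i ‖² → ‖ q′ ⊖ p i ‖² ≤ ‖ q′ ⊖ p j ‖² → p i ≋ p j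
      near-j i j≤i i≤j k = sym (‖x⊖y‖²≤0⇒x≋y (begin
        ‖ p j ⊖ p i ‖²
          ≤⟨ ≤-by (+-nonneg (*-nonneg (proj₁ 0<K) (x≤y⇒0≤y-x i≤j))
                            (*-nonneg (x≤y⇒0≤y-x 1≤K) (x≤y⇒0≤y-x j≤i)))
                  (trans (+-congʳ (gap (p i) (p j)))
                    (solve 5 (λ L j i jj ji → L :* (j :- i) :+ (jj :- ji) :+ L :* (i :- j) := jj :- ji) refl
                      (K - 1#) ‖ q ⊖ p j ‖² ‖ q ⊖ p i ‖² ‖ p j ⊖ p j ‖² ‖ p j ⊖ p i ‖²)) ⟩
        ‖ p j ⊖ p j ‖²
          ≈⟨ ‖x⊖x‖²≈0 (p j) ⟩
        0# ∎) k)

-- Relevant points and nearest neighbors.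

module RelevantPoints {c ℓ₁ ℓ₂} (ℝ : Reals c ℓ₁ ℓ₂) {d n : ℕ} {C : Set}
                      (_≟ᶜ_ : DecidableEquality C) (T : Fin n → Euclidean.Point ℝ d) (class : Fin n → C)
                      (T-injective : Injective _≡_ (Euclidean._≋_ ℝ d) T) where
  open Reals ℝ hiding (zero)
  open RealProperties ℝ
  open Euclidean ℝ d
  open EuclideanProperties ℝ d
  open Training ℝ T class
  open Graph {n}
  open import Relation.Binary.Reasoning.PartialOrder (DecTotalOrder.poset decTotalOrder)

  -- Enumerates `InvertedSet r` by all of `Fin n`, as `extreme-above` requires: indices of the class
  -- of `r`, which have no image, are sent to the centre.
  invertedPoint : Fin n → Fin n → Point
  invertedPoint r t with class t ≟ᶜ class r
  ... | yes _ = T r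
  ... | no  _ = invert (T r) (T t)

  invertedPoint-view : ∀ r t → (class t ≡ class r × invertedPoint r t ≡ T r) ⊎
                               (class t ≢ class r × invertedPoint r t ≡ invert (T r) (T t))
  invertedPoint-view r t with class t ≟ᶜ class r
  ... | yes t≡r = inj₁ (t≡r , ≡.refl)
  ... | no  t≢r = inj₂ (t≢r , ≡.refl)

  invertedPoint-∈ : ∀ r t → InvertedSet r (invertedPoint r t)
  invertedPoint-∈ r t with class t ≟ᶜ class r
  ... | yes _   = r , centre
  ... | no  t≢r = t , image t≢r

  invertedPoint-onto : ∀ r x → InvertedSet r x → ∃[ t ] x ≡ invertedPoint r t
  invertedPoint-onto r _ (_ , centre) with invertedPoint-view r r
  ... | inj₁ (_ , p≡) = r , ≡.sym p≡
  ... | inj₂ (r≢r , _) = contradiction ≡.refl r≢r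
  invertedPoint-onto r _ (t , image t≢r) with invertedPoint-view r t
  ... | inj₁ (t≡r , _) = contradiction t≡r t≢r
  ... | inj₂ (_ , p≡) = t , ≡.sym p≡

  dist² : Point → Fin n → Carrier
  dist² q i = ‖ q ⊖ T i ‖²

  ≢-class⇒≉ : ∀ {r t} → class t ≢ class r → ¬ T t ≋ T r
  ≢-class⇒≉ t≢r Tt≋Tr = t≢r (≡.cong class (T-injective Tt≋Tr))

  -- Maximising in direction `q ⊖ T r` from the image of `u` gives an extreme point of height above
  -- 1. It is not the centre, so it is the image of some `t`, and `inversion-gap` read backwards
  -- puts `t` closer to `q` than `r`.
  closer-relevant : ∀ {E r u q} → Relevant E r → class u ≢ class r → dist² q u < dist² q r →
                    ∃[ t ] Relevant E t × dist² q t < dist² q r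
  closer-relevant {E} {r} {u} {q} r∈R u≢r u<r = t , t-closer (invertedPoint-view r t)
    where
    a = q ⊖ T r
    h = height q (T r)

    maximiser = extreme-above (invertedPoint r) (invertedPoint-∈ r) (invertedPoint-onto r) a u
    t       = proj₁ maximiser
    above   = proj₁ (proj₂ maximiser)
    extreme = proj₂ (proj₂ maximiser)

    h-u : 0# < h (invert (T r) (T u)) - 1#
    h-u = *-pos-cancelˡ (‖‖²-nonneg _)
      (begin-strict
        0#                          <⟨ x<y⇒0<y-x u<r ⟩
        dist² q r - dist² q u       ≈⟨ inversion-gap q (≢-class⇒≉ u≢r) ⟩
        ‖ T u ⊖ T r ‖² * (h (invert (T r) (T u)) - 1#) ∎)

    above′ : a ∙ invert (T r) (T u) ≤ a ∙ invertedPoint r t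
    above′ with invertedPoint-view r u
    ... | inj₁ (u≡r , _) = contradiction u≡r u≢r
    ... | inj₂ (_ , p≡)  = ≡.subst (λ p → a ∙ p ≤ a ∙ invertedPoint r t) p≡ above

    h-t : 0# < h (invertedPoint r t) - 1#
    h-t = height-mono h-u above′

    t-closer : (class t ≡ class r × invertedPoint r t ≡ T r) ⊎
               (class t ≢ class r × invertedPoint r t ≡ invert (T r) (T t)) →
               Relevant E t × dist² q t < dist² q r
    t-closer (inj₁ (_ , p≡)) = contradiction
      (proj₁ (≡.subst (λ p → 0# < h p - 1#) p≡ h-t))
      (<⇒≱ (height-centre q (T r)))
    t-closer (inj₂ (t≢r , p≡)) =
      step r∈R (image t≢r) (≡.subst (Extreme (InvertedSet r)) p≡ extreme) ,
      <-by (*-pos (≰⇒> (≢-class⇒≉ t≢r ∘ ‖x⊖y‖²≤0⇒x≋y)) (≡.subst (λ p → 0# < h p - 1#) p≡ h-t))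
           (sym (inversion-gap q (≢-class⇒≉ t≢r)))

  -- The class changes along some edge of the walk. The tree lists this edge in one of two orders,
  -- hence the two initial constructors.
  relevant-on-walk : ∀ {E i j} → Star (Adjacent E) i j → class i ≢ class j → ∃ (Relevant E)
  relevant-on-walk ε i≢j = contradiction ≡.refl i≢j
  relevant-on-walk {i = i} (_◅_ {j = k} adjacent walk) i≢j with class i ≟ᶜ class k | adjacent
  ... | yes i≡k | _        = relevant-on-walk walk (i≢j ∘ ≡.trans i≡k)
  ... | no  i≢k | inj₁ i-k = i , initialˡ i-k i≢k
  ... | no  i≢k | inj₂ k-i = i , initialʳ k-i (i≢k ∘ ≡.sym)

  -- Squared distances order points as distances do, and they are polynomial in the coordinates.
  Nearest² : ∀ {p} → Pred (Fin n) p → Point → Pred (Fin n) (ℓ₂ ⊔ p)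
  Nearest² S q i = S i × (∀ j → S j → dist² q i ≤ dist² q j)

  nearest⇒nearest² : ∀ {p} {S : Pred (Fin n) p} {q i} → Nearest S q i → Nearest² S q i
  nearest⇒nearest² {q = q} (i∈S , i≤) = i∈S , λ j j∈S → dist-cancel-≤ {q} {_} {q} (i≤ j j∈S)

  nearest²⇒nearest : ∀ {p} {S : Pred (Fin n) p} {q i} → Nearest² S q i → Nearest S q i
  nearest²⇒nearest {q = q} (i∈S , i≤) = i∈S , λ j j∈S → dist-mono-≤ {q} {_} {q} (i≤ j j∈S)

  closer⇒same-class : ∀ {E q r u} → Nearest² (Relevant E) q r → dist² q u < dist² q r →
                      class u ≡ class r
  closer⇒same-class {r = r} {u} (r∈R , r≤) u<r with class u ≟ᶜ class r
  ... | yes u≡r = u≡r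
  ... | no  u≢r with closer-relevant r∈R u≢r u<r
  ...   | t , t∈R , t<r = contradiction (r≤ t t∈R) (<⇒≱ t<r)

  -- Minimising over the relevant points requires deciding relevance, which `excluded-middle`
  -- provides.
  nearest-relevant : ∀ {E} → ∃ (Relevant E) → ∀ q → ∃ (Nearest² (Relevant E) q)
  nearest-relevant {E} nonempty q = minimum (excluded-middle ∘ Relevant E) (dist² q) nonempty

  -- Let `j` be nearest among all training points. Either `r` is as near as `j` and serves itself,
  -- or `j` is strictly closer and so has the class of `r`.
  relevant⇒all : ∀ {E q k} → NNClassification (Relevant E) q k → NNClassification U q k
  relevant⇒all {E} {q} (r , nearest , ≡.refl) = compare (minimum (λ _ → yes tt) (dist² q) (r , tt))
    where
    compare : ∃ (Nearest² U q) → NNClassification U q (class r)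
    compare (j , j∈U , j≤) with dist² q r ≤? dist² q j
    ... | yes r≤j = r , nearest²⇒nearest (tt , λ i i∈U → ≤-trans r≤j (j≤ i i∈U)) , ≡.refl
    ... | no  r≰j = j , nearest²⇒nearest (j∈U , j≤) ,
                    closer⇒same-class (nearest⇒nearest² nearest) (≰⇒> r≰j)

  -- At `q` a relevant point may tie with `j` and have another class, so the witness `r′` is taken
  -- nearest to the moved query `q′`. By `near-r` it is still a nearest relevant point to `q`. If
  -- `j` is strictly closer to `q′`, the classes agree by `closer⇒same-class`; otherwise `near-j`
  -- makes `r′` and `j` the same point.
  all⇒relevant : ∀ {E} → ∃ (Relevant E) → ∀ {q k} →
                 NNClassification U q k → NNClassification (Relevant E) q k
  all⇒relevant {E} nonempty {q} (j , nearest-j , ≡.refl) = move (nearest-relevant nonempty q)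
    where
    move : ∃ (Nearest² (Relevant E) q) → NNClassification (Relevant E) q (class j)
    move (r , r∈R , r≤) = choose (perturbation T q j r)
      where
      choose : Perturbation T q j r → NNClassification (Relevant E) q (class j)
      choose (q′ , near-r , near-j) = conclude (nearest-relevant nonempty q′)
        where
        conclude : ∃ (Nearest² (Relevant E) q′) → NNClassification (Relevant E) q (class j)
        conclude (r′ , nearest-r′@(r′∈R , r′≤)) =
          r′ ,
          nearest²⇒nearest (r′∈R , λ i i∈R → ≤-trans (near-r r′ (r′≤ r r∈R)) (r≤ i i∈R)) ,
          same-class
          where
          same-class : class r′ ≡ class j
          same-class with dist² q′ r′ ≤? dist² q′ j
          ... | no  r′≰j = ≡.sym (closer⇒same-class nearest-r′ (≰⇒> r′≰j))
          ... | yes r′≤j = ≡.cong class (T-injective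
            (near-j r′ (proj₂ (nearest⇒nearest² nearest-j) r′ tt) r′≤j))

-- Two points of different classes ensure that some point is relevant. If a nonempty training set
-- had one class only, no tree edge would join different classes, and the empty set of relevant
-- points would classify nothing.
theorem1 : ∀ {c ℓ₁ ℓ₂} (ℝ : Reals c ℓ₁ ℓ₂) (d n : ℕ) {C : Set} → DecidableEquality C →
    (T : Fin n → Euclidean.Point ℝ d) (class : Fin n → C) →
    let open Euclidean ℝ d
        open Training ℝ T class in
    Injective _≡_ _≋_ T →
    ∃₂ (λ i j → class i ≢ class j) →
    ∀ E → IsEuclideanMST E →
    ∀ (q : Point) (k : C) →
    NNClassification (Relevant E) q k ⇔ NNClassification U q k
theorem1 ℝ d n _≟ᶜ_ T class T-injective (i , j , i≢j) E ((_ , connected , _) , _) q k =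
  mk⇔ relevant⇒all (all⇒relevant (relevant-on-walk (connected i j) i≢j))
  where open RelevantPoints ℝ _≟ᶜ_ T class T-injective
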